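{- The number of weighted rooted trees of total weight $n$ containing a specified limb is independent of the structure of the limb: if $L_1$ and $L_2$ are weighted rooted trees, each with at least three vertices, having the same total weight $\ell$, then for every $n$ the number of weighted rooted trees of total weight $n$ that have $L_1$ as a limb equals the number of weighted rooted trees of total weight $n$ that have $L_2$ as a limb.
   Context: A weighted rooted tree is a finite rooted tree in which each vertex is assigned a positive integer weight. Its total weight is the sum of the weights of all its vertices. Weighted rooted trees are counted up to isomorphism preserving the root and the vertex weights. Let $T$ be a weighted rooted tree and $v\in V(T)$. A branch at $v$ is a weighted subtree of $T$, rooted at $v$, consisting of $v$, one child $v'$ of $v$, and all descendants of $v'$ in $T$, with weights inherited from $T$. A limb at $v$ is a weighted rooted subtree of $T$ with root $v$ that consists of a collection of branches at $v$. The tree $T$ has $L$ as a limb if for some $v\in V(T)$ there is a limb at $v$ isomorphic to $L$ as a weighted rooted tree. -}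

module Defs where

open import Data.Fin.Base using (Fin)
open import Data.List.Base using (List; []; _∷_; length; lookup)
open import Data.List.Relation.Binary.Sublist.Propositional using (_⊆_)
open import Data.Nat.Base using (ℕ; suc; _+_; NonZero)
open import Data.Product.Base using (Σ-syntax; ∃-syntax; _×_; proj₁)
open import Function.Bundles using (_↔_; _⇔_; Inverse)
open import Function.Construct.Composition using (_↔-∘_; _⇔-∘_)
open import Function.Construct.Identity using (↔-id; ⇔-id)
open import Function.Construct.Symmetry using (↔-sym; ⇔-sym)
open import Level using (0ℓ)
open import Relation.Binary.Bundles using (Setoid)
import Relation.Binary.Construct.On as On
open import Relation.Binary.PropositionalEquality
  using (_≡_; refl; sym; trans; cong; subst₂)
import Relation.Binary.PropositionalEquality.Properties as ≡

-- The list order of the children carries no meaning: trees are only ever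
-- compared through the relation _≅_ below.
data Tree : Set where
  node : (w : ℕ) .{{_ : NonZero w}} → List Tree → Tree

mutual
  totalWeight : Tree → ℕ
  totalWeight (node w ts) = w + forestWeight ts

  forestWeight : List Tree → ℕ
  forestWeight []       = 0
  forestWeight (t ∷ ts) = totalWeight t + forestWeight ts

mutual
  numVertices : Tree → ℕ
  numVertices (node _ ts) = suc (forestVertices ts)

  forestVertices : List Tree → ℕ
  forestVertices []       = 0
  forestVertices (t ∷ ts) = numVertices t + forestVertices ts

data Vertex : Tree → Set where
  root  : ∀ {t} → Vertex t
  below : ∀ {w} .{{_ : NonZero w}} {ts} (i : Fin (length ts)) →
          Vertex (lookup ts i) → Vertex (node w ts)

-- The subtree consisting of v and all its descendants, rooted at v.
subtreeAt : ∀ t → Vertex t → Tree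
subtreeAt t           root        = t
subtreeAt (node w ts) (below i v) = subtreeAt (lookup ts i) v

rootWeight : Tree → ℕ
rootWeight (node w _) = w

weightAt : ∀ {t} → Vertex t → ℕ
weightAt {t} v = rootWeight (subtreeAt t v)

-- u ⇝ v : the vertex v is a child of the vertex u.
infix 4 _⇝_
data _⇝_ : ∀ {t} → Vertex t → Vertex t → Set where
  top  : ∀ {w} .{{_ : NonZero w}} {ts} (i : Fin (length ts)) →
         root ⇝ below {w} {ts} i root
  deep : ∀ {w} .{{_ : NonZero w}} {ts} (i : Fin (length ts))
         {u v : Vertex (lookup ts i)} →
         u ⇝ v → below {w} {ts} i u ⇝ below i v

infix 4 _≅_
record _≅_ (s t : Tree) : Set where
  field
    bijection : Vertex s ↔ Vertex t

  open Inverse bijection public using (to; from; strictlyInverseˡ)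

  field
    to-root   : to root ≡ root
    to-child  : ∀ u v → u ⇝ v ⇔ to u ⇝ to v
    to-weight : ∀ v → weightAt (to v) ≡ weightAt v

≅-refl : ∀ {t} → t ≅ t
≅-refl = record
  { bijection = ↔-id _
  ; to-root   = refl
  ; to-child  = λ _ _ → ⇔-id _
  ; to-weight = λ _ → refl
  }

≅-sym : ∀ {s t} → s ≅ t → t ≅ s
≅-sym {s} {t} e = record
  { bijection = ↔-sym bijection
  ; to-root   = trans (cong from (sym to-root)) (strictlyInverseʳ root)
  ; to-child  = λ u v → ⇔-sym
      (subst₂ (λ u′ v′ → from u ⇝ from v ⇔ u′ ⇝ v′)
        (strictlyInverseˡ u) (strictlyInverseˡ v)
        (to-child (from u) (from v)))
  ; to-weight = λ v →
      trans (sym (to-weight (from v))) (cong weightAt (strictlyInverseˡ v))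
  }
  where
  open _≅_ e
  open Inverse bijection using (strictlyInverseʳ)

≅-trans : ∀ {s t u} → s ≅ t → t ≅ u → s ≅ u
≅-trans e f = record
  { bijection = F.bijection ↔-∘ E.bijection
  ; to-root   = trans (cong F.to E.to-root) F.to-root
  ; to-child  = λ u v → F.to-child (E.to u) (E.to v) ⇔-∘ E.to-child u v
  ; to-weight = λ v → trans (F.to-weight (E.to v)) (E.to-weight v)
  }
  where
  module E = _≅_ e
  module F = _≅_ f

treeSetoid : Setoid 0ℓ 0ℓ
treeSetoid = record
  { Carrier       = Tree
  ; _≈_           = _≅_
  ; isEquivalence = record { refl = ≅-refl ; sym = ≅-sym ; trans = ≅-trans }
  }

-- A branch at v is determined by the subtree hanging from a child of v, so a
-- limb of t at its root keeps the root together with some of the children's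
-- subtrees.
infix 4 _LimbAtRootOf_
data _LimbAtRootOf_ : Tree → Tree → Set where
  limb : ∀ {w} .{{_ : NonZero w}} {us ts} →
         us ⊆ ts → node w us LimbAtRootOf node w ts

HasLimb : Tree → Tree → Set
HasLimb t l =
  Σ[ v ∈ Vertex t ] ∃[ k ] (k LimbAtRootOf subtreeAt t v × k ≅ l)

-- Trees of total weight n having l as a limb, identified when isomorphic.
treesWithLimb : ℕ → Tree → Setoid 0ℓ 0ℓ
treesWithLimb n l = On.setoid treeSetoid
  (proj₁ {B = λ t → totalWeight t ≡ n × HasLimb t l})

-- The setoid S has exactly k equivalence classes.
HasCardinality : Setoid 0ℓ 0ℓ → ℕ → Set
HasCardinality S k = Inverse S (≡.setoid (Fin k))

{-# OPTIONS --safe #-}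
module Submission where

-- Both counts agree with the count for the one-vertex limb of weight ℓ.  For
-- L = node w₁ us with w₁ < ℓ, let Φ act recursively on the children and then
-- exchange, at the root, (ℓ , ts) with (w₁ , us ++ ts), fixing all other roots.
-- Φ keeps the total weight and is injective up to isomorphism; since L cannot
-- occur inside the lighter trees us, t has a vertex of weight ℓ iff Φ t has L
-- as a limb.  So Φ injects the trees with the one-vertex limb into those with
-- L, and the trees without it into those without L; as both splittings have
-- the same finite total, the counts are equal.

open import Defs
open import Data.Nat.Properties
open import Algebra.Properties.CommutativeSemigroup +-commutativeSemigroup using (x∙yz≈y∙xz)
open import Data.Fin.Base using (Fin; zero; suc; punchIn)
open import Data.Fin.Permutation using (Permutation; permutation; remove; punchIn-permute; _⟨$⟩ʳ_; _⟨$⟩ˡ_)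
open import Data.Fin.Properties using (injective⇒≤)
open import Data.List.Base using (List; []; _∷_; _++_; length; lookup; tabulate; filter;
  cartesianProduct; cartesianProductWith; deduplicate; upTo)
open import Data.List.Membership.Propositional using (find; lose) renaming (_∈_ to _∈ₚ_)
import Data.List.Membership.Propositional.Properties as ∈ₚ
import Data.List.Membership.Setoid as Membership
import Data.List.Membership.Setoid.Properties as ∈
open import Data.List.Properties using (tabulate-lookup)
open import Data.List.Relation.Binary.Permutation.Propositional using (↭⇒↭ₛ′) renaming (_↭_ to _↭ₚ_)
import Data.List.Relation.Binary.Permutation.Propositional as Permₚ
import Data.List.Relation.Binary.Permutation.Homogeneous as Hom
import Data.List.Relation.Binary.Permutation.Setoid as Perm
import Data.List.Relation.Binary.Permutation.Setoid.Properties as Permₛ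
open import Data.List.Relation.Binary.Pointwise.Base using ([]; _∷_)
open import Data.List.Relation.Binary.Sublist.Propositional using (_⊆_; ⊆-refl; []; _∷_; _∷ʳ_)
import Data.List.Relation.Binary.Sublist.Propositional.Properties as Sublist
open import Data.List.Relation.Unary.All as All using (All; []; _∷_)
open import Data.List.Relation.Unary.AllPairs using (_∷_)
open import Data.List.Relation.Unary.Any as Any using (Any; here; there; index)
import Data.List.Relation.Unary.Any.Properties as Any
open import Data.List.Relation.Unary.Unique.DecSetoid.Properties using (deduplicate-!)
import Data.List.Relation.Unary.Unique.Setoid as Unique
import Data.List.Relation.Unary.Unique.Setoid.Properties as Uniqueₚ
open import Data.Nat.Base using (ℕ; zero; suc; _+_; _≤_; s≤s; NonZero; >-nonZero; >-nonZero⁻¹)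
open import Data.Product.Base using (∃; ∃₂; ∃-syntax; _×_; _,_; proj₁; proj₂)
open import Data.Sum.Base as Sum using (_⊎_; inj₁; inj₂; [_,_]′)
open import Function.Base using (_∘_)
open import Function.Bundles using (Equivalence; mk↔ₛ′; mk⇔)
open import Level using (Level)
open import Relation.Binary.Bundles using (Setoid; DecSetoid)
import Relation.Binary.Construct.On as On
open import Relation.Binary.Construct.Closure.ReflexiveTransitive using (Star; ε; _◅_; gmap)
open import Relation.Binary.Definitions using () renaming (Decidable to Decidable₂)
open import Relation.Binary.PropositionalEquality
  using (_≡_; _≢_; refl; sym; trans; cong; cong₂; subst; subst₂)
open import Relation.Nullary using (¬_; Dec; yes; no; contradiction)
open import Relation.Nullary.Decidable using (map′; _×-dec_; _⊎-dec_; ¬?)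
open import Relation.Unary using (Pred; Decidable)

private variable
  a p : Level
  w w′ n : ℕ
  s t : Tree
  ss ts us : List Tree

-- Permutations up to a setoid equality

module SetoidLists {a ℓ} (S : Setoid a ℓ) where
  open Setoid S using (_≈_; isEquivalence) renaming (Carrier to A; refl to ≈-refl; sym to ≈-sym; trans to ≈-trans)
  open Perm S
  open Permₛ S
  open Membership S using (_∈_)
  open Unique S using (Unique)

  -- The permutation is propositional although `P` may speak of setoid equality: it can then be
  -- carried through functions such as `Φs` that are not known to respect isomorphism.
  extract : {P : Pred A p} {xs : List A} → Any P xs →
            ∃₂ λ x rest → P x × xs ↭ₚ x ∷ rest
  extract (here px) = _ , _ , px , Permₚ.refl
  extract {xs = y ∷ _} (there pxs) with x , rest , px , eq ← extract pxs =
    x , y ∷ rest , px , Permₚ.trans (Permₚ.prep y eq) (Permₚ.swap y x Permₚ.refl)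

  ↭ₚ⇒↭ : {xs ys : List A} → xs ↭ₚ ys → xs ↭ ys
  ↭ₚ⇒↭ = ↭⇒↭ₛ′ isEquivalence

  ↭-uncons : ∀ {x xs ys} → x ∷ xs ↭ ys →
             ∃₂ λ y rest → x ≈ y × ys ↭ₚ y ∷ rest × xs ↭ rest
  ↭-uncons x∷xs↭ys
    with y , rest , x≈y , eq ← extract (∈-resp-↭ x∷xs↭ys (here ≈-refl)) =
    y , rest , x≈y , eq ,
    drop-∷ (↭-trans x∷xs↭ys (↭-trans (↭ₚ⇒↭ eq) (Hom.prep (≈-sym x≈y) ↭-refl)))

  ++-cancelˡ-↭ : ∀ xs {ys zs} → xs ++ ys ↭ xs ++ zs → ys ↭ zs
  ++-cancelˡ-↭ []       eq = eq
  ++-cancelˡ-↭ (x ∷ xs) eq = ++-cancelˡ-↭ xs (drop-∷ eq)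

  tabulate-pull : ∀ {n} (g : Fin (suc n) → A) j →
                  tabulate g ↭ₚ g j ∷ tabulate (g ∘ punchIn j)
  tabulate-pull         g zero    = Permₚ.refl
  tabulate-pull {suc n} g (suc j) =
    Permₚ.trans (Permₚ.prep (g zero) (tabulate-pull (g ∘ suc) j))
                (Permₚ.swap (g zero) (g (suc j)) Permₚ.refl)

  -- Induction on `m`: `π` sends `zero` to `j`, so `g j` is pulled to the front, and `remove zero π`
  -- matches the other entries, with those of `g` renumbered by `punchIn j`.
  tabulate-↭ : ∀ {m n} (f : Fin m → A) (g : Fin n → A) (π : Permutation m n) →
               (∀ i → f i ≈ g (π ⟨$⟩ʳ i)) → tabulate f ↭ tabulate g
  tabulate-↭ {zero}  {zero}  f g π f≈g = ↭-refl
  tabulate-↭ {zero}  {suc n} f g π f≈g with () ← π ⟨$⟩ˡ zero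
  tabulate-↭ {suc m} {zero}  f g π f≈g with () ← π ⟨$⟩ʳ zero
  tabulate-↭ {suc m} {suc n} f g π f≈g = ↭-trans
    (Hom.prep (f≈g zero) (tabulate-↭ (f ∘ suc) (g ∘ punchIn j) (remove zero π)
      (λ i → subst (f (suc i) ≈_) (cong g (punchIn-permute π zero i)) (f≈g (suc i)))))
    (↭-sym (↭ₚ⇒↭ (tabulate-pull g j)))
    where j = π ⟨$⟩ʳ zero

  lookup-↭ : ∀ {xs ys} (π : Permutation (length xs) (length ys)) →
             (∀ i → lookup xs i ≈ lookup ys (π ⟨$⟩ʳ i)) → xs ↭ ys
  lookup-↭ {xs} {ys} π eq =
    subst₂ _↭_ (tabulate-lookup xs) (tabulate-lookup ys)
      (tabulate-↭ (lookup xs) (lookup ys) π eq)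

  ⊆⇒↭++ : ∀ {xs ys : List A} → xs ⊆ ys → ∃ λ rest → ys ↭ xs ++ rest
  ⊆⇒↭++ [] = [] , ↭-refl
  ⊆⇒↭++ {xs} (y ∷ʳ xs⊆ys) with rest , eq ← ⊆⇒↭++ xs⊆ys =
    y ∷ rest , ↭-trans (↭-prep y eq) (↭-sym (↭-shift xs rest))
  ⊆⇒↭++ (refl ∷ xs⊆ys) with rest , eq ← ⊆⇒↭++ xs⊆ys =
    rest , ↭-prep _ eq

  -- The permutation may reorder and replace the chosen entries, so the sublist is rebuilt along its
  -- derivation; a swap has four cases, by which of the two swapped entries are chosen.
  ⊆-transport : ∀ {xs ys zs : List A} → xs ⊆ ys → ys ↭ zs →
                ∃ λ xs′ → xs′ ⊆ zs × xs′ ↭ xs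
  ⊆-transport []         (Hom.refl [])           = [] , [] , ↭-refl
  ⊆-transport (_ ∷ʳ sub) (Hom.refl (_ ∷ eqs))
    with xs′ , sub′ , eq ← ⊆-transport sub (Hom.refl eqs) = xs′ , _ ∷ʳ sub′ , eq
  ⊆-transport (refl ∷ sub) (Hom.refl (e ∷ eqs))
    with xs′ , sub′ , eq ← ⊆-transport sub (Hom.refl eqs) =
    _ , refl ∷ sub′ , Hom.prep (≈-sym e) eq
  ⊆-transport (_ ∷ʳ sub) (Hom.prep e p)
    with xs′ , sub′ , eq ← ⊆-transport sub p = xs′ , _ ∷ʳ sub′ , eq
  ⊆-transport (refl ∷ sub) (Hom.prep e p)
    with xs′ , sub′ , eq ← ⊆-transport sub p = _ , refl ∷ sub′ , Hom.prep (≈-sym e) eq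
  ⊆-transport (_ ∷ʳ (_ ∷ʳ sub)) (Hom.swap e f p)
    with xs′ , sub′ , eq ← ⊆-transport sub p = xs′ , _ ∷ʳ _ ∷ʳ sub′ , eq
  ⊆-transport (_ ∷ʳ (refl ∷ sub)) (Hom.swap e f p)
    with xs′ , sub′ , eq ← ⊆-transport sub p = _ , refl ∷ _ ∷ʳ sub′ , Hom.prep (≈-sym f) eq
  ⊆-transport (refl ∷ (_ ∷ʳ sub)) (Hom.swap e f p)
    with xs′ , sub′ , eq ← ⊆-transport sub p = _ , _ ∷ʳ refl ∷ sub′ , Hom.prep (≈-sym e) eq
  ⊆-transport (refl ∷ (refl ∷ sub)) (Hom.swap e f p)
    with xs′ , sub′ , eq ← ⊆-transport sub p =
    _ , refl ∷ refl ∷ sub′ , Hom.swap (≈-sym f) (≈-sym e) eq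
  ⊆-transport sub (Hom.trans p q)
    with xs′ , sub′ , eq ← ⊆-transport sub p
    with xs″ , sub″ , eq′ ← ⊆-transport sub′ q = xs″ , sub″ , ↭-trans eq′ eq

  module _ (_≈?_ : Decidable₂ _≈_) where

    -- Greedy matching is complete: entries equal to `u` are interchangeable and `drop-∷` cancels
    -- the matched pair, so failure after one choice rules out every other choice.
    ↭++? : ∀ us xs → Dec (∃ λ rest → xs ↭ us ++ rest)
    ↭++? []       xs = yes (xs , ↭-refl)
    ↭++? (u ∷ us) xs with Any.any? (u ≈?_) xs
    ... | no u∉xs = no λ (_ , eq) → u∉xs (∈-resp-↭ (↭-sym eq) (here ≈-refl))
    ... | yes u∈xs with y , ys , u≈y , xs↭ ← extract u∈xs with ↭++? us ys
    ...   | yes (rest , eq) =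
      yes (rest , ↭-trans (↭ₚ⇒↭ xs↭) (Hom.prep (≈-sym u≈y) eq))
    ...   | no ¬sub = no λ (rest , eq) → ¬sub (rest , drop-∷
      (↭-trans (Hom.prep u≈y ↭-refl) (↭-trans (↭-sym (↭ₚ⇒↭ xs↭)) eq)))

  lookup-injective : ∀ {xs} → Unique xs → ∀ i j → lookup xs i ≈ lookup xs j → i ≡ j
  lookup-injective (_ ∷ _)    zero    zero    eq = refl
  lookup-injective (x∉ ∷ _)   zero    (suc j) eq = contradiction eq (All.lookup x∉ (∈ₚ.∈-lookup j))
  lookup-injective (x∉ ∷ _)   (suc i) zero    eq = contradiction (≈-sym eq) (All.lookup x∉ (∈ₚ.∈-lookup i))
  lookup-injective (_ ∷ uniq) (suc i) (suc j) eq = cong suc (lookup-injective uniq i j eq)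

  -- Pigeonhole on positions: equal indices in `ys` give equal images, `f` reflects equality, and
  -- `xs` has no repetitions, so the induced map of positions is injective.
  injection⇒length≤ : ∀ {xs ys} → Unique xs → (f : A → A) →
                      (∀ {x y} → f x ≈ f y → x ≈ y) →
                      (∀ {x} → x ∈ₚ xs → f x ∈ ys) → length xs ≤ length ys
  injection⇒length≤ {xs} {ys} uniq f f-inj f∈ =
    injective⇒≤ {f = λ i → index (f∈ (∈ₚ.∈-lookup i))} λ {i} {j} eq →
      lookup-injective uniq i j (f-inj (≈-trans (Any.lookup-index (f∈ (∈ₚ.∈-lookup i)))
        (≈-trans (Setoid.reflexive S (cong (lookup ys) eq))
          (≈-sym (Any.lookup-index (f∈ (∈ₚ.∈-lookup j)))))))

-- Isomorphism of trees in terms of their children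

open Perm treeSetoid using (_↭_; ↭-refl; ↭-sym; ↭-trans)
open Permₛ treeSetoid using (∈-resp-↭; Any-resp-↭; drop-∷; ++⁺ʳ; ++⁺ˡ)
open Membership treeSetoid using (_∈_)
open SetoidLists treeSetoid
open _≅_ using (to; from; to-root; to-child; to-weight)

-- Applying `g-child` to an edge `f u ⇝ f v` and cancelling with `gf` shows that `f` also reflects
-- edges.
fromInverses : (f : Vertex s → Vertex t) (g : Vertex t → Vertex s) →
               (∀ v → f (g v) ≡ v) → (∀ u → g (f u) ≡ u) → f root ≡ root →
               (∀ {u v} → u ⇝ v → f u ⇝ f v) → (∀ {u v} → u ⇝ v → g u ⇝ g v) →
               (∀ u → weightAt (f u) ≡ weightAt u) → s ≅ t
fromInverses f g fg gf f-root f-child g-child f-weight = record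
  { bijection = mk↔ₛ′ f g fg gf
  ; to-root   = f-root
  ; to-child  = λ u v → mk⇔ f-child λ e → subst₂ _⇝_ (gf u) (gf v) (g-child e)
  ; to-weight = f-weight
  }

-- Takes two independent isomorphisms, so that one lemma serves both `e` with `≅-sym e` and the
-- reverse pair.
LeftInverse : s ≅ t → t ≅ s → Set
LeftInverse e e′ = ∀ v → to e (to e′ v) ≡ v

to∘from : (e : s ≅ t) → LeftInverse e (≅-sym e)
to∘from e = _≅_.strictlyInverseˡ e

from∘to : (e : s ≅ t) → LeftInverse (≅-sym e) e
from∘to e = to∘from (≅-sym e)

to-⇝ : (e : s ≅ t) → ∀ {u v} → u ⇝ v → to e u ⇝ to e v
to-⇝ e = Equivalence.to (to-child e _ _)

-- Isomorphisms built from permutations of the children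

module _ {w} .{{_ : NonZero w}} where

  skip : Vertex (node w ts) → Vertex (node w (t ∷ ts))
  skip root        = root
  -- The matched constructor brings a second instance NonZero w into scope;
  -- the hole {{_}} avoids an ambiguous instance search here and below.
  skip (below i v) = below {{_}} (suc i) v

  skip-⇝ : {u v : Vertex (node w ts)} → u ⇝ v → skip {t = t} u ⇝ skip v
  skip-⇝ (top i)    = top {{_}} (suc i)
  skip-⇝ (deep i e) = deep {{_}} (suc i) e

  skip-weight : (v : Vertex (node w ts)) → weightAt (skip {t = t} v) ≡ weightAt v
  skip-weight root        = refl
  skip-weight (below i v) = refl

  module _ {s t ss ts} (e : s ≅ t) (es : node w ss ≅ node w ts) where

    consMap : Vertex (node w (s ∷ ss)) → Vertex (node w (t ∷ ts))
    consMap root              = root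
    consMap (below zero v)    = below {{_}} zero (to e v)
    consMap (below (suc i) v) = skip (to es (below {{_}} i v))

    -- An image under `to es` is not in constructor form, so `consMap-inverse` needs this for every
    -- `v`, the root included.
    consMap-skip : ∀ v → consMap (skip v) ≡ skip (to es v)
    consMap-skip root        = cong skip (sym (to-root es))
    consMap-skip (below i v) = refl

    consMap-⇝ : ∀ {u v} → u ⇝ v → consMap u ⇝ consMap v
    consMap-⇝ (top {{nz}} zero) =
      subst (λ v → root ⇝ below {{nz}} zero v) (sym (to-root e)) (top {{nz}} zero)
    consMap-⇝ (top (suc i)) =
      subst (_⇝ skip (to es (below {{_}} i root))) (cong skip (to-root es)) (skip-⇝ (to-⇝ es (top {{_}} i)))
    consMap-⇝ (deep zero u⇝v)    = deep {{_}} zero (to-⇝ e u⇝v)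
    consMap-⇝ (deep (suc i) u⇝v) = skip-⇝ (to-⇝ es (deep {{_}} i u⇝v))

    consMap-weight : ∀ v → weightAt (consMap v) ≡ weightAt v
    consMap-weight root              = refl
    consMap-weight (below zero v)    = to-weight e v
    consMap-weight (below (suc i) v) = trans (skip-weight (to es (below {{_}} i v))) (to-weight es (below {{_}} i v))

  consMap-inverse : (e : s ≅ t) (e′ : t ≅ s) (es : node w ss ≅ node w ts) (es′ : node w ts ≅ node w ss) →
                    LeftInverse e e′ → LeftInverse es es′ →
                    ∀ v → consMap e es (consMap e′ es′ v) ≡ v
  consMap-inverse e e′ es es′ inv invs root              = refl
  consMap-inverse e e′ es es′ inv invs (below zero v)    = cong (below {{_}} zero) (inv v)
  consMap-inverse e e′ es es′ inv invs (below (suc i) v) =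
    trans (consMap-skip e es (to es′ (below {{_}} i v))) (cong skip (invs (below {{_}} i v)))

  node-∷ : s ≅ t → node w ss ≅ node w ts → node w (s ∷ ss) ≅ node w (t ∷ ts)
  node-∷ e es = fromInverses (consMap e es) (consMap e⁻¹ es⁻¹)
    (consMap-inverse e e⁻¹ es es⁻¹ (to∘from e) (to∘from es))
    (consMap-inverse e⁻¹ e es⁻¹ es (from∘to e) (from∘to es)) refl
    (consMap-⇝ e es) (consMap-⇝ e⁻¹ es⁻¹) (consMap-weight e es)
    where
    e⁻¹  = ≅-sym e
    es⁻¹ = ≅-sym es

  swapMap : Vertex (node w (s ∷ t ∷ ts)) → Vertex (node w (t ∷ s ∷ ts))
  swapMap root                    = root
  swapMap (below zero v)          = below {{_}} (suc zero) v
  swapMap (below (suc zero) v)    = below {{_}} zero v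
  swapMap (below (suc (suc i)) v) = below {{_}} (suc (suc i)) v

  swapMap-involutive : (v : Vertex (node w (s ∷ t ∷ ts))) → swapMap (swapMap v) ≡ v
  swapMap-involutive root                    = refl
  swapMap-involutive (below zero v)          = refl
  swapMap-involutive (below (suc zero) v)    = refl
  swapMap-involutive (below (suc (suc i)) v) = refl

  swapMap-⇝ : {u v : Vertex (node w (s ∷ t ∷ ts))} → u ⇝ v → swapMap u ⇝ swapMap v
  swapMap-⇝ (top zero)             = top {{_}} (suc zero)
  swapMap-⇝ (top (suc zero))       = top {{_}} zero
  swapMap-⇝ (top (suc (suc i)))    = top {{_}} (suc (suc i))
  swapMap-⇝ (deep zero e)          = deep {{_}} (suc zero) e
  swapMap-⇝ (deep (suc zero) e)    = deep {{_}} zero e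
  swapMap-⇝ (deep (suc (suc i)) e) = deep {{_}} (suc (suc i)) e

  swapMap-weight : (v : Vertex (node w (s ∷ t ∷ ts))) → weightAt (swapMap v) ≡ weightAt v
  swapMap-weight root                    = refl
  swapMap-weight (below zero v)          = refl
  swapMap-weight (below (suc zero) v)    = refl
  swapMap-weight (below (suc (suc i)) v) = refl

  node-swap : node w (s ∷ t ∷ ts) ≅ node w (t ∷ s ∷ ts)
  node-swap = fromInverses swapMap swapMap swapMap-involutive swapMap-involutive refl
    swapMap-⇝ swapMap-⇝ swapMap-weight

  node⁺ : ss ↭ ts → node w ss ≅ node w ts
  node⁺ (Hom.refl [])         = ≅-refl
  node⁺ (Hom.refl (e ∷ es))   = node-∷ e (node⁺ (Hom.refl es))
  node⁺ (Hom.prep e p)        = node-∷ e (node⁺ p)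
  node⁺ (Hom.swap e f p)      = ≅-trans (node-∷ e (node-∷ f (node⁺ p))) node-swap
  node⁺ (Hom.trans p q)       = ≅-trans (node⁺ p) (node⁺ q)

  -- Permutations of the children read off from isomorphisms

  root-⇝ : {v : Vertex (node w ts)} → root ⇝ v → ∃ λ i → v ≡ below i root
  root-⇝ (top i) = i , refl

  below-⇝ : ∀ {i} {u : Vertex (lookup ts i)} {v : Vertex (node w ts)} →
            below i u ⇝ v → ∃ λ v′ → v ≡ below i v′ × u ⇝ v′
  below-⇝ (deep i e) = _ , refl , e

  below-injective : ∀ {i} {u v : Vertex (lookup ts i)} →
                    below {w} {ts} i u ≡ below i v → u ≡ v
  below-injective refl = refl

  below-injectiveⁱ : ∀ {i j} {u : Vertex (lookup ts i)} {v : Vertex (lookup ts j)} →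
                     below {w} {ts} i u ≡ below j v → i ≡ j
  below-injectiveⁱ refl = refl

-- The path allows an induction along edges, which is all that an isomorphism is known to preserve
-- inside a branch.
reachable : (v : Vertex t) → Star _⇝_ root v
reachable root        = ε
reachable (below i v) = top i ◅ gmap (below i) (deep i) (reachable v)

module _ {w w′} .{{_ : NonZero w}} .{{_ : NonZero w′}} where

  childImage : (e : node w ss ≅ node w′ ts) (i : Fin (length ss)) →
               ∃ λ j → to e (below i root) ≡ below j root
  childImage e i = root-⇝ (subst (_⇝ to e (below i root)) (to-root e) (to-⇝ e (top i)))

  module _ (e : node w ss ≅ node w′ ts) {i j} (i↦j : to e (below i root) ≡ below j root) where

    -- Edges are preserved, and a child of a vertex below `j` is again below `j`, so the image of
    -- the path from child `i` to `v` never leaves that branch.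
    descend : ∀ v → ∃ λ v′ → to e (below i v) ≡ below j v′
    descend v = go (reachable v) (root , i↦j)
      where
      go : ∀ {u v} → Star _⇝_ u v → (∃ λ u′ → to e (below i u) ≡ below j u′) →
           ∃ λ v′ → to e (below i v) ≡ below j v′
      go ε u↦ = u↦
      go (_◅_ {j = x} u⇝x path) (u′ , eq)
        with x′ , eq′ , _ ← below-⇝ (subst (_⇝ to e (below i x)) eq (to-⇝ e (deep i u⇝x))) =
        go path (x′ , eq′)

    descend-⇝ : ∀ {u v} → u ⇝ v → proj₁ (descend u) ⇝ proj₁ (descend v)
    descend-⇝ {u} {v} u⇝v with v′ , eq , edge ← below-⇝ (subst₂ _⇝_ (proj₂ (descend u)) (proj₂ (descend v)) (to-⇝ e (deep i u⇝v))) =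
      subst (_ ⇝_) (sym (below-injective eq)) edge

  inverse-↦ : (e : node w ss ≅ node w′ ts) (e′ : node w′ ts ≅ node w ss) → LeftInverse e′ e →
              ∀ {i j} → to e (below i root) ≡ below j root → to e′ (below j root) ≡ below i root
  inverse-↦ e e′ inv i↦j = trans (cong (to e′) (sym i↦j)) (inv _)

module _ {w w′} .{{_ : NonZero w}} .{{_ : NonZero w′}} where

  -- `descend` is applied with `w` and `w′` in both orders. Inside its own module these parameters
  -- are fixed, hence the fresh module; likewise for the modules that follow.
  descend-inverse : (e : node w ss ≅ node w′ ts) (e′ : node w′ ts ≅ node w ss) → LeftInverse e e′ →
                    ∀ {i j} (i↦j : to e (below i root) ≡ below j root)
                    (j↦i : to e′ (below j root) ≡ below i root) →
                    ∀ v → proj₁ (descend e i↦j (proj₁ (descend e′ j↦i v))) ≡ v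
  descend-inverse e e′ inv i↦j j↦i v with u , eq ← descend e′ j↦i v =
    below-injective (trans (sym (proj₂ (descend e i↦j u)))
      (trans (cong (to e) (sym eq)) (inv _)))

module _ {w w′} .{{_ : NonZero w}} .{{_ : NonZero w′}} where

  descend-≅ : (e : node w ss ≅ node w′ ts) → ∀ {i j} →
              to e (below i root) ≡ below j root → lookup ss i ≅ lookup ts j
  descend-≅ e {i} i↦j = fromInverses
    (λ u → proj₁ (descend e i↦j u)) (λ v → proj₁ (descend e⁻¹ j↦i v))
    (descend-inverse e e⁻¹ (to∘from e) i↦j j↦i) (descend-inverse e⁻¹ e (from∘to e) j↦i i↦j)
    (below-injective (trans (sym (proj₂ (descend e i↦j root))) i↦j))
    (descend-⇝ e i↦j) (descend-⇝ e⁻¹ j↦i)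
    (λ u → trans (cong weightAt (sym (proj₂ (descend e i↦j u)))) (to-weight e (below i u)))
    where
    e⁻¹ = ≅-sym e
    j↦i = inverse-↦ e e⁻¹ (from∘to e) i↦j

  node⁻-weight : node w ss ≅ node w′ ts → w ≡ w′
  node⁻-weight e = sym (trans (cong weightAt (sym (to-root e))) (to-weight e root))

module _ {w w′} .{{_ : NonZero w}} .{{_ : NonZero w′}} where

  childImage-inverse : (e : node w ss ≅ node w′ ts) (e′ : node w′ ts ≅ node w ss) → LeftInverse e e′ →
                       ∀ j → proj₁ (childImage e (proj₁ (childImage e′ j))) ≡ j
  childImage-inverse e e′ inv j with i , j↦i ← childImage e′ j =
    below-injectiveⁱ (trans (sym (proj₂ (childImage e i))) (inverse-↦ e′ e inv j↦i))

module _ {w w′} .{{_ : NonZero w}} .{{_ : NonZero w′}} where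

  -- Edges at the root go to edges at the root, so `childImage` permutes the positions of the
  -- children, and `descend-≅` restricts the isomorphism to each child's subtree.
  node⁻ : node w ss ≅ node w′ ts → ss ↭ ts
  node⁻ e = lookup-↭
    (permutation (proj₁ ∘ childImage e) (proj₁ ∘ childImage (≅-sym e))
      (childImage-inverse e (≅-sym e) (to∘from e)) (childImage-inverse (≅-sym e) e (from∘to e)))
    (λ i → descend-≅ e (proj₂ (childImage e i)))

node-cong : .{{_ : NonZero w}} .{{_ : NonZero w′}} → w ≡ w′ → ss ↭ ts → node w ss ≅ node w′ ts
node-cong refl = node⁺ {{_}}

-- Deciding isomorphism

mutual
  infix 4 _≅?_
  _≅?_ : Decidable₂ _≅_
  node w ss ≅? node w′ ts = map′ (λ (w≡ , p) → node-cong w≡ p) (λ e → node⁻-weight e , node⁻ e)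
    ((w ≟ w′) ×-dec (ss ↭? ts))

  -- Greedy, as in `↭++?`. The recursion is on the first forest, because `rest` is not a subterm of
  -- `ts`.
  _↭?_ : Decidable₂ _↭_
  []       ↭? []       = yes ↭-refl
  []       ↭? (t ∷ ts) = no λ eq → contradiction (↭-sym eq) (Permₛ.¬x∷xs↭[] treeSetoid)
  (s ∷ ss) ↭? ts with Any.any? (s ≅?_) ts
  ... | no s∉ts = no λ eq → s∉ts (∈-resp-↭ eq (here ≅-refl))
  ... | yes s∈ts with t , rest , s≅t , ts↭ ← extract s∈ts with ss ↭? rest
  ...   | yes eq = yes (↭-trans (Hom.prep s≅t eq) (↭-sym (↭ₚ⇒↭ ts↭)))
  ...   | no neq = no λ eq → neq (drop-∷ (↭-trans (Hom.prep (≅-sym s≅t) ↭-refl) (↭-trans eq (↭ₚ⇒↭ ts↭))))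

-- Weights

forestWeight-↭ₚ : ss ↭ₚ ts → forestWeight ss ≡ forestWeight ts
forestWeight-↭ₚ Permₚ.refl       = refl
forestWeight-↭ₚ (Permₚ.prep t p) = cong (totalWeight t +_) (forestWeight-↭ₚ p)
forestWeight-↭ₚ {s ∷ t ∷ _} (Permₚ.swap s t p) =
  trans (cong (λ k → totalWeight s + (totalWeight t + k)) (forestWeight-↭ₚ p))
        (x∙yz≈y∙xz (totalWeight s) (totalWeight t) _)
forestWeight-↭ₚ (Permₚ.trans p q) = trans (forestWeight-↭ₚ p) (forestWeight-↭ₚ q)

mutual
  -- The recursion is on the tree `s`: the isomorphisms of children that `node⁻` and `↭-uncons`
  -- produce are not subterms of the given one.
  totalWeight-≅ : ∀ s → s ≅ t → totalWeight s ≡ totalWeight t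
  totalWeight-≅ {t = node _ _} (node _ ss) e = cong₂ _+_ (node⁻-weight e) (forestWeight-↭ ss (node⁻ e))

  forestWeight-↭ : ∀ ss → ss ↭ ts → forestWeight ss ≡ forestWeight ts
  forestWeight-↭ {[]}    []       eq = refl
  forestWeight-↭ {_ ∷ _} []       eq = contradiction (↭-sym eq) (Permₛ.¬x∷xs↭[] treeSetoid)
  forestWeight-↭         (s ∷ ss) eq with _ , _ , s≅t , ts↭ , eq′ ← ↭-uncons eq =
    trans (cong₂ _+_ (totalWeight-≅ s s≅t) (forestWeight-↭ ss eq′)) (sym (forestWeight-↭ₚ ts↭))

forestWeight-++ : ∀ ss → forestWeight (ss ++ ts) ≡ forestWeight ss + forestWeight ts
forestWeight-++ []       = refl
forestWeight-++ (s ∷ ss) =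
  trans (cong (totalWeight s +_) (forestWeight-++ ss)) (sym (+-assoc (totalWeight s) _ _))

totalWeight≤forestWeight : t ∈ₚ ts → totalWeight t ≤ forestWeight ts
totalWeight≤forestWeight (here refl)            = m≤m+n _ _
totalWeight≤forestWeight {ts = s ∷ _} (there t∈ts) =
  ≤-trans (totalWeight≤forestWeight t∈ts) (m≤n+m _ (totalWeight s))

-- Limbs

-- A limb at the root, restated without the intermediate tree and its isomorphism. This form passes
-- along permutations directly and is decided by `↭++?`.
RootLimb : ℕ → List Tree → Tree → Set
RootLimb w ts (node w₁ us) = w ≡ w₁ × ∃ λ rest → ts ↭ us ++ rest

AnyLimb : List Tree → Tree → Set
AnyLimb ts l = Any (λ t → HasLimb t l) ts

module _ {w} .{{_ : NonZero w}} where

  limbAtRoot⁻ : ∀ {k} l → k LimbAtRootOf node w ts → k ≅ l → RootLimb w ts l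
  limbAtRoot⁻ (node _ us) (limb us′⊆ts) k≅l with rest , eq ← ⊆⇒↭++ us′⊆ts =
    node⁻-weight k≅l , rest , ↭-trans eq (++⁺ʳ rest (node⁻ k≅l))

  hasLimb⁻ : ∀ l → HasLimb (node w ts) l → AnyLimb ts l ⊎ RootLimb w ts l
  hasLimb⁻ l (root , _ , k-limb , k≅l) = inj₂ (limbAtRoot⁻ l k-limb k≅l)
  hasLimb⁻ l (below i v , has)         = inj₁ (lose (∈ₚ.∈-lookup i) (v , has))

  hasLimb-below : ∀ {l} → AnyLimb ts l → HasLimb (node w ts) l
  hasLimb-below has = let v , h = Any.lookup-index has in below (index has) v , h

  hasLimb-root : ∀ l → RootLimb w ts l → HasLimb (node w ts) l
  hasLimb-root (node _ us) (refl , rest , eq)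
    -- `us` is a prefix of `us ++ rest`; carried back along the permutation it becomes an actual
    -- sublist of `ts`, equal to `us` only up to permutation.
    with us′ , us′⊆ts , us′↭us ← ⊆-transport (Sublist.++⁺ʳ rest ⊆-refl) (↭-sym eq) =
    root , node w us′ , limb us′⊆ts , node⁺ us′↭us

rootLimb-↭ : ∀ l → w ≡ w′ → ss ↭ ts → RootLimb w ss l → RootLimb w′ ts l
rootLimb-↭ (node _ _) w≡w′ ss↭ts (w≡ , rest , eq) =
  trans (sym w≡w′) w≡ , rest , ↭-trans (↭-sym ss↭ts) eq

-- Recursion on the vertex, which is therefore a separate argument: one step down replaces `e` by
-- the isomorphism it induces between corresponding branches.
hasLimbAt-≅ : ∀ l → s ≅ t → (v : Vertex s) →
              ∃[ k ] (k LimbAtRootOf subtreeAt s v × k ≅ l) → HasLimb t l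
hasLimbAt-≅ {s = node _ _} {t = node _ _} l e root (k , k-limb , k≅l) =
  hasLimb-root l (rootLimb-↭ l (node⁻-weight e) (node⁻ e) (limbAtRoot⁻ l k-limb k≅l))
hasLimbAt-≅ {t = node _ _} l e (below i v) has with j , i↦j ← childImage e i =
  hasLimb-below (lose (∈ₚ.∈-lookup j) (hasLimbAt-≅ l (descend-≅ e i↦j) v has))

hasLimb-≅ : ∀ l → s ≅ t → HasLimb s l → HasLimb t l
hasLimb-≅ l e (v , has) = hasLimbAt-≅ l e v has

anyLimb-↭ : ∀ l → ss ↭ ts → AnyLimb ss l → AnyLimb ts l
anyLimb-↭ l = Any-resp-↭ (hasLimb-≅ l)

mutual
  hasLimb? : ∀ l t → Dec (HasLimb t l)
  hasLimb? l@(node w₁ us) (node w ts) = map′ [ hasLimb-below , hasLimb-root l ]′ (hasLimb⁻ l)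
    (anyLimb? l ts ⊎-dec ((w ≟ w₁) ×-dec ↭++? _≅?_ us ts))

  anyLimb? : ∀ l ts → Dec (AnyLimb ts l)
  anyLimb? l []       = no λ ()
  anyLimb? l (t ∷ ts) = map′ Any.fromSum Any.toSum (hasLimb? l t ⊎-dec anyLimb? l ts)

hasLimb⇒totalWeight≤ : ∀ l → HasLimb t l → totalWeight l ≤ totalWeight t
hasLimb⇒totalWeight≤ {t = node w ts} l@(node w₁ us) (root , k , k-limb , k≅l)
  with refl , rest , eq ← limbAtRoot⁻ l k-limb k≅l = +-monoʳ-≤ w (begin
    forestWeight us                     ≤⟨ m≤m+n _ _ ⟩
    forestWeight us + forestWeight rest ≡⟨ forestWeight-++ us ⟨
    forestWeight (us ++ rest)           ≡⟨ forestWeight-↭ ts eq ⟨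
    forestWeight ts                     ∎)
  where open ≤-Reasoning
hasLimb⇒totalWeight≤ {t = node w ts} l (below i v , has) = begin
  totalWeight l             ≤⟨ hasLimb⇒totalWeight≤ l (v , has) ⟩
  totalWeight (lookup ts i) ≤⟨ totalWeight≤forestWeight {ts = ts} (∈ₚ.∈-lookup i) ⟩
  forestWeight ts           ≤⟨ m≤n+m _ w ⟩
  w + forestWeight ts       ∎
  where open ≤-Reasoning

-- Exchanging a single vertex of weight ℓ for a limb of total weight ℓ

singleVertex : ∀ ℓ .{{_ : NonZero ℓ}} → Tree
singleVertex ℓ = node ℓ []

module LimbExchange (w₁ : ℕ) .{{_ : NonZero w₁}} (us : List Tree) where

  L : Tree
  L = node w₁ us

  ℓ : ℕ
  ℓ = totalWeight L

  private instance
    ℓ-nonZero : NonZero ℓ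
    ℓ-nonZero = >-nonZero (≤-trans (>-nonZero⁻¹ w₁) (m≤m+n w₁ _))

  L₀ : Tree
  L₀ = singleVertex ℓ

  -- A limb weighs no more than a tree containing it, while `us` altogether weighs `w₁` less than
  -- `L`.
  us-limbless : ¬ AnyLimb us L
  us-limbless has with t , t∈us , h ← find has =
    <⇒≱ (m<n+m (forestWeight us) (>-nonZero⁻¹ w₁))
        (≤-trans (hasLimb⇒totalWeight≤ L h) (totalWeight≤forestWeight t∈us))

  -- The root exchange as a relation, so that later proofs split on what happened and not on how it
  -- was decided. In `detach` any valid remainder `rest` is allowed.
  data Exchange : ℕ → List Tree → Tree → Set where
    attach : Exchange ℓ ts (node w₁ (us ++ ts))
    detach : ∀ {rest} → ts ↭ us ++ rest → Exchange w₁ ts (node ℓ rest)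
    keep   : .{{_ : NonZero w}} → w ≢ ℓ → ¬ RootLimb w ts L → Exchange w ts (node w ts)

  exchange : ∀ w .{{_ : NonZero w}} ts → ∃ (Exchange w ts)
  exchange w ts with w ≟ ℓ | w ≟ w₁ | ↭++? _≅?_ us ts
  ... | yes refl | _        | _              = _ , attach
  ... | no w≢ℓ   | yes refl | yes (rest , p) = _ , detach p
  ... | no w≢ℓ   | yes refl | no ¬sub        = _ , keep w≢ℓ (¬sub ∘ proj₂)
  ... | no w≢ℓ   | no w≢w₁  | _              = _ , keep w≢ℓ (w≢w₁ ∘ proj₁)

  exchange-weight : Exchange w ts t → totalWeight t ≡ w + forestWeight ts
  exchange-weight attach =
    trans (cong (w₁ +_) (forestWeight-++ us)) (sym (+-assoc w₁ _ _))
  exchange-weight {ts = ts} (detach eq) =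
    trans (+-assoc w₁ _ _)
          (cong (w₁ +_) (sym (trans (forestWeight-↭ ts eq) (forestWeight-++ us))))
  exchange-weight (keep _ _) = refl

  mutual
    Φ : Tree → Tree
    Φ (node w ts) = proj₁ (exchange w (Φs ts))

    Φs : List Tree → List Tree
    Φs []       = []
    Φs (t ∷ ts) = Φ t ∷ Φs ts

  mutual
    Φ-weight : ∀ t → totalWeight (Φ t) ≡ totalWeight t
    Φ-weight (node w ts) =
      trans (exchange-weight (proj₂ (exchange w (Φs ts)))) (cong (w +_) (Φs-weight ts))

    Φs-weight : ∀ ts → forestWeight (Φs ts) ≡ forestWeight ts
    Φs-weight []       = refl
    Φs-weight (t ∷ ts) = cong₂ _+_ (Φ-weight t) (Φs-weight ts)

  Φs-↭ₚ : ss ↭ₚ ts → Φs ss ↭ₚ Φs ts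
  Φs-↭ₚ Permₚ.refl         = Permₚ.refl
  Φs-↭ₚ (Permₚ.prep t p)   = Permₚ.prep (Φ t) (Φs-↭ₚ p)
  Φs-↭ₚ (Permₚ.swap s t p) = Permₚ.swap (Φ s) (Φ t) (Φs-↭ₚ p)
  Φs-↭ₚ (Permₚ.trans p q)  = Permₚ.trans (Φs-↭ₚ p) (Φs-↭ₚ q)

  Φs-extract : Any (λ t → s ≅ t) (Φs ts) → Any (λ t → s ≅ Φ t) ts
  Φs-extract {ts = _ ∷ _} (here e)   = here e
  Φs-extract {ts = _ ∷ _} (there es) = there (Φs-extract es)

  module _ (w₁≢ℓ : w₁ ≢ ℓ) where

    -- Here `ts` are the children after `Φs`, and `w ≡ ℓ` records a one-vertex limb at the old root.
    -- Under `detach` a copy of `L` cannot disappear with `us`, by `us-limbless`, so it survives in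
    -- the remainder.
    exchange-limb⁺ : Exchange w ts t → AnyLimb ts L ⊎ w ≡ ℓ → HasLimb t L
    exchange-limb⁺ {ts = ts} attach _             = hasLimb-root L (refl , ts , ↭-refl)
    exchange-limb⁺ (detach eq)      (inj₂ w₁≡ℓ)   = contradiction w₁≡ℓ w₁≢ℓ
    exchange-limb⁺ (detach eq)      (inj₁ has)
      with Any.++⁻ us (anyLimb-↭ L eq has)
    ... | inj₁ in-us   = contradiction in-us us-limbless
    ... | inj₂ in-rest = hasLimb-below in-rest
    exchange-limb⁺ (keep _ _)       (inj₁ has)    = hasLimb-below has
    exchange-limb⁺ (keep w≢ℓ _)     (inj₂ w≡ℓ)    = contradiction w≡ℓ w≢ℓ

    -- Only `attach` yields `L` at the root: after `detach` the root weight is `ℓ`, which differs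
    -- from `w₁`, and `keep` excludes it outright.
    exchange-limb⁻ : Exchange w ts t → HasLimb t L → AnyLimb ts L ⊎ w ≡ ℓ
    exchange-limb⁻ attach      _   = inj₂ refl
    exchange-limb⁻ (detach eq) has with hasLimb⁻ L has
    ... | inj₁ in-rest    = inj₁ (anyLimb-↭ L (↭-sym eq) (Any.++⁺ʳ us in-rest))
    ... | inj₂ (ℓ≡w₁ , _) = contradiction (sym ℓ≡w₁) w₁≢ℓ
    exchange-limb⁻ (keep _ ¬limb) has with hasLimb⁻ L has
    ... | inj₁ in-ts   = inj₁ in-ts
    ... | inj₂ at-root = contradiction at-root ¬limb

    mutual
      Φ-limb⁺ : ∀ t → HasLimb t L₀ → HasLimb (Φ t) L
      Φ-limb⁺ (node w ts) has = exchange-limb⁺ (proj₂ (exchange w (Φs ts)))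
        -- Since `L₀` has no branches, being a limb at the root amounts to the weight equation
        -- selected by `proj₁`.
        (Sum.map (Φs-limb⁺ ts) proj₁ (hasLimb⁻ L₀ has))

      Φs-limb⁺ : ∀ ts → AnyLimb ts L₀ → AnyLimb (Φs ts) L
      Φs-limb⁺ (t ∷ ts) (here has)  = here (Φ-limb⁺ t has)
      Φs-limb⁺ (t ∷ ts) (there has) = there (Φs-limb⁺ ts has)

    mutual
      Φ-limb⁻ : ∀ t → HasLimb (Φ t) L → HasLimb t L₀
      Φ-limb⁻ (node w ts) has with exchange-limb⁻ (proj₂ (exchange w (Φs ts))) has
      ... | inj₁ any = hasLimb-below (Φs-limb⁻ ts any)
      ... | inj₂ w≡ℓ = hasLimb-root L₀ (w≡ℓ , ts , ↭-refl)

      Φs-limb⁻ : ∀ ts → AnyLimb (Φs ts) L → AnyLimb ts L₀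
      Φs-limb⁻ (t ∷ ts) (here has)  = here (Φ-limb⁻ t has)
      Φs-limb⁻ (t ∷ ts) (there has) = there (Φs-limb⁻ ts has)

    -- The result reveals the case: `L` at the root means `attach`, root weight `ℓ` means `detach`,
    -- neither means `keep`. Within one case the children are recovered by cancelling or restoring
    -- `us`.
    exchange-injective : Exchange w ss s → Exchange w′ ts t → s ≅ t → w ≡ w′ × ss ↭ ts
    exchange-injective attach attach e = refl , ++-cancelˡ-↭ us (node⁻ e)
    exchange-injective attach (detach _) e = contradiction (node⁻-weight e) w₁≢ℓ
    exchange-injective attach (keep _ ¬limb) e =
      contradiction (sym (node⁻-weight e) , _ , ↭-sym (node⁻ e)) ¬limb
    exchange-injective (detach _) attach e = contradiction (sym (node⁻-weight e)) w₁≢ℓ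
    exchange-injective (detach p) (detach q) e =
      refl , ↭-trans p (↭-trans (++⁺ˡ us (node⁻ e)) (↭-sym q))
    exchange-injective (detach _) (keep w′≢ℓ _) e = contradiction (sym (node⁻-weight e)) w′≢ℓ
    exchange-injective (keep _ ¬limb) attach e =
      contradiction (node⁻-weight e , _ , node⁻ e) ¬limb
    exchange-injective (keep w≢ℓ _) (detach _) e = contradiction (node⁻-weight e) w≢ℓ
    exchange-injective (keep _ _) (keep _ _) e = node⁻-weight e , node⁻ e

    mutual
      Φ-injective : ∀ s {t} → Φ s ≅ Φ t → s ≅ t
      Φ-injective (node w ss) {node w′ ts} e
        with w≡w′ , eq ← exchange-injective (proj₂ (exchange w (Φs ss))) (proj₂ (exchange w′ (Φs ts))) e =
        node-cong w≡w′ (Φs-injective ss eq)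

      -- The image of `s` matches the image of some `t` in `ts`. Moving `t` to the front commutes
      -- with `Φs` by `Φs-↭ₚ`, after which both heads cancel.
      Φs-injective : ∀ ss {ts} → Φs ss ↭ Φs ts → ss ↭ ts
      Φs-injective []       {[]}    eq = ↭-refl
      Φs-injective []       {_ ∷ _} eq = contradiction (↭-sym eq) (Permₛ.¬x∷xs↭[] treeSetoid)
      Φs-injective (s ∷ ss) eq
        with t , rest , Φs≅Φt , ts↭ ← extract (Φs-extract (∈-resp-↭ eq (here ≅-refl))) =
        ↭-trans (Hom.prep (Φ-injective s Φs≅Φt) (Φs-injective ss (drop-∷
            (↭-trans eq (↭-trans (↭ₚ⇒↭ (Φs-↭ₚ ts↭)) (Hom.prep (≅-sym Φs≅Φt) ↭-refl))))))
          (↭-sym (↭ₚ⇒↭ ts↭))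

-- Enumeration

-- `n` bounds both the depth of the recursion and the root weights, which run from 1 to `n`. Heavier
-- forests may occur too; `treesOfWeight` filters by exact weight.
forests : ℕ → List (List Tree)
forests zero    = [] ∷ []
forests (suc n) = [] ∷ cartesianProductWith (λ k (ts , rest) → node (suc k) ts ∷ rest)
  (upTo (suc n)) (cartesianProduct (forests n) (forests n))

-- Removing the root of the first tree lowers the weight by at least one, so its children and its
-- siblings both meet the bound of the recursive calls.
forests-complete : ∀ n ts → forestWeight ts ≤ n → ts ∈ₚ forests n
forests-complete zero    []                        _  = here refl
forests-complete (suc n) []                        _  = here refl
forests-complete n       (node zero {{nz}} _ ∷ _)  _  = contradiction (>-nonZero⁻¹ 0 {{nz}}) n≮0
forests-complete (suc n) (node (suc k) ts ∷ rest) (s≤s le) =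
  there (∈ₚ.∈-cartesianProductWith⁺ _ (∈ₚ.∈-upTo⁺ (s≤s (≤-trans (m≤m+n k _) (≤-trans (m≤m+n _ _) le))))
    (∈ₚ.∈-cartesianProduct⁺
      (forests-complete n ts (≤-trans (m≤n+m _ k) (≤-trans (m≤m+n _ _) le)))
      (forests-complete n rest (≤-trans (m≤n+m _ (k + forestWeight ts)) le))))

trees : ℕ → List Tree
trees n = cartesianProductWith (λ k ts → node (suc k) ts) (upTo n) (forests n)

trees-complete : ∀ t → totalWeight t ≤ n → t ∈ₚ trees n
trees-complete (node zero {{nz}} _) _  = contradiction (>-nonZero⁻¹ 0 {{nz}}) n≮0
trees-complete (node (suc k) ts)    le =
  ∈ₚ.∈-cartesianProductWith⁺ _ (∈ₚ.∈-upTo⁺ (≤-trans (s≤s (m≤m+n k _)) le))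
    (forests-complete _ ts (≤-trans (m≤n+m _ (suc k)) le))

open Unique treeSetoid using (Unique)

treeDecSetoid : DecSetoid _ _
treeDecSetoid = record
  { isDecEquivalence = record { isEquivalence = Setoid.isEquivalence treeSetoid ; _≟_ = _≅?_ } }

treesOfWeight : ℕ → List Tree
treesOfWeight n = deduplicate _≅?_ (filter (λ t → totalWeight t ≟ n) (trees n))

treesOfWeight-unique : ∀ n → Unique (treesOfWeight n)
treesOfWeight-unique n = deduplicate-! treeDecSetoid _

treesOfWeight-weight : t ∈ₚ treesOfWeight n → totalWeight t ≡ n
treesOfWeight-weight {n = n} t∈ =
  proj₂ (∈ₚ.∈-filter⁻ (λ t → totalWeight t ≟ n) {xs = trees n} (∈ₚ.∈-deduplicate⁻ _≅?_ _ t∈))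

treesOfWeight-complete : ∀ t → totalWeight t ≡ n → t ∈ treesOfWeight n
treesOfWeight-complete {n = n} t refl =
  ∈.∈-deduplicate⁺ treeSetoid _≅?_ (λ e f → ≅-trans f (≅-sym e))
    (Any.map (Setoid.reflexive treeSetoid)
      (∈ₚ.∈-filter⁺ (λ t → totalWeight t ≟ n) (trees-complete t ≤-refl) refl))

-- The index found by `complete` could vary with the proof of `P t`; uniqueness makes it depend only
-- on the isomorphism class.
enumeration⇒cardinality : {P : Tree → Set} (xs : List Tree) → Unique xs →
  (∀ {t} → t ∈ₚ xs → P t) → (∀ {t} → P t → t ∈ xs) →
  HasCardinality (On.setoid treeSetoid (proj₁ {B = P})) (length xs)
enumeration⇒cardinality xs uniq sound complete = record
  { to        = λ (_ , p) → index (complete p)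
  ; from      = λ i → lookup xs i , sound (∈ₚ.∈-lookup i)
  ; to-cong   = λ {x} {y} e → lookup-injective uniq _ _
      (≅-trans (≅-sym (Any.lookup-index (complete (proj₂ x))))
        (≅-trans e (Any.lookup-index (complete (proj₂ y)))))
  ; from-cong = λ { refl → ≅-refl }
  ; inverse   =
      (λ {i} {x} e → lookup-injective uniq _ _
        (≅-trans (≅-sym (Any.lookup-index (complete (proj₂ x)))) e))
    , (λ { {x} refl → ≅-sym (Any.lookup-index (complete (proj₂ x))) })
  }

-- Comparing the counts

length-filter-complement : {A : Set a} {P : Pred A p} (P? : Decidable P) (xs : List A) →
  length (filter P? xs) + length (filter (¬? ∘ P?) xs) ≡ length xs
length-filter-complement P? [] = refl
length-filter-complement P? (x ∷ xs) with P? x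
... | yes _ = cong suc (length-filter-complement P? xs)
... | no  _ = trans (+-suc _ _) (cong suc (length-filter-complement P? xs))

withLimb withoutLimb : ℕ → Tree → List Tree
withLimb    n l = filter (hasLimb? l) (treesOfWeight n)
withoutLimb n l = filter (¬? ∘ hasLimb? l) (treesOfWeight n)

withLimb-cardinality : ∀ n l → HasCardinality (treesWithLimb n l) (length (withLimb n l))
withLimb-cardinality n l = enumeration⇒cardinality (withLimb n l)
  (Uniqueₚ.filter⁺ treeSetoid (hasLimb? l) (treesOfWeight-unique n))
  (λ t∈ → let t∈n , has = ∈ₚ.∈-filter⁻ (hasLimb? l) {xs = treesOfWeight n} t∈ in treesOfWeight-weight {n = n} t∈n , has)
  (λ (weight , has) → ∈.∈-filter⁺ treeSetoid (hasLimb? l) (hasLimb-≅ l) (treesOfWeight-complete _ weight) has)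

withLimb-length : ∀ n ℓ .{{_ : NonZero ℓ}} l → 2 ≤ numVertices l → totalWeight l ≡ ℓ →
                  length (withLimb n l) ≡ length (withLimb n (singleVertex ℓ))
withLimb-length n _ (node _ []) (s≤s ()) _
withLimb-length n _ (node w₁ us@(node w₂ _ ∷ _)) _ refl =
  ≤-antisym
    -- Both splittings have the same total, so the bound `without≤` on the complements reverses into
    -- the missing inequality.
    (+-cancelʳ-≤ _ _ _ (begin
      length (withLimb n L) + length (withoutLimb n L₀)   ≤⟨ +-monoʳ-≤ _ without≤ ⟩
      length (withLimb n L) + length (withoutLimb n L)    ≡⟨ length-filter-complement (hasLimb? L) (treesOfWeight n) ⟩
      length (treesOfWeight n)                            ≡⟨ length-filter-complement (hasLimb? L₀) (treesOfWeight n) ⟨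
      length (withLimb n L₀) + length (withoutLimb n L₀)  ∎))
    with≤
  where
  open LimbExchange w₁ us
  open ≤-Reasoning

  w₁≢ℓ : w₁ ≢ ℓ
  -- The root of the first child alone adds `w₂`, which is positive.
  w₁≢ℓ = <⇒≢ (m<m+n w₁ (≤-trans (>-nonZero⁻¹ w₂) (≤-trans (m≤m+n w₂ _) (m≤m+n _ _))))

  Φ∈ : ∀ {t} → t ∈ₚ treesOfWeight n → Φ t ∈ treesOfWeight n
  Φ∈ {t} t∈ = treesOfWeight-complete (Φ t) (trans (Φ-weight t) (treesOfWeight-weight {n = n} t∈))

  with≤ : length (withLimb n L₀) ≤ length (withLimb n L)
  with≤ = injection⇒length≤
    (Uniqueₚ.filter⁺ treeSetoid (hasLimb? L₀) (treesOfWeight-unique n))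
    Φ (Φ-injective w₁≢ℓ _) λ {t} t∈ →
      let t∈n , has = ∈ₚ.∈-filter⁻ (hasLimb? L₀) {xs = treesOfWeight n} t∈ in
      ∈.∈-filter⁺ treeSetoid (hasLimb? L) (hasLimb-≅ L) (Φ∈ t∈n) (Φ-limb⁺ w₁≢ℓ t has)

  without≤ : length (withoutLimb n L₀) ≤ length (withoutLimb n L)
  without≤ = injection⇒length≤
    (Uniqueₚ.filter⁺ treeSetoid (¬? ∘ hasLimb? L₀) (treesOfWeight-unique n))
    Φ (Φ-injective w₁≢ℓ _) λ {t} t∈ →
      let t∈n , hasn't = ∈ₚ.∈-filter⁻ (¬? ∘ hasLimb? L₀) {xs = treesOfWeight n} t∈ in
      -- Lacking `L` passes along `e`, since a copy of `L` would be carried back along `≅-sym e`.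
      ∈.∈-filter⁺ treeSetoid (¬? ∘ hasLimb? L) (λ e ¬has has → ¬has (hasLimb-≅ L (≅-sym e) has))
        (Φ∈ t∈n) (hasn't ∘ Φ-limb⁻ w₁≢ℓ t)

totalWeight-nonZero : ∀ t → NonZero (totalWeight t)
totalWeight-nonZero (node w _) = >-nonZero (≤-trans (>-nonZero⁻¹ w) (m≤m+n w _))

mainTheorem3 : (ℓ : ℕ) (L₁ L₂ : Tree) →
    3 ≤ numVertices L₁ → 3 ≤ numVertices L₂ →
    totalWeight L₁ ≡ ℓ → totalWeight L₂ ≡ ℓ →
    (n : ℕ) →
    ∃[ k ] (HasCardinality (treesWithLimb n L₁) k × HasCardinality (treesWithLimb n L₂) k)
mainTheorem3 ℓ L₁ L₂ 3≤L₁ 3≤L₂ refl L₂≡ℓ n =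
  length (withLimb n L₁) , withLimb-cardinality n L₁ ,
  subst (HasCardinality (treesWithLimb n L₂))
    (trans (withLimb-length n ℓ L₂ (<⇒≤ 3≤L₂) L₂≡ℓ) (sym (withLimb-length n ℓ L₁ (<⇒≤ 3≤L₁) refl)))
    (withLimb-cardinality n L₂)
  -- The comparison tree `singleVertex ℓ` requires `ℓ`, now the weight of `L₁`, to be positive.
  where instance _ = totalWeight-nonZero L₁
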